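{- The proof system consisting of Axiom (A) and Rules (R1)–(R6) is sound and complete for sentences: for every finite set $\Gamma$ of sentences and every sentence $\gamma$, $\Gamma\vdash\gamma$ if and only if $\Gamma\models\gamma$.
   Context: Setting (real-valued logic). Fix a finite set of atomic propositions, a finite set of binary connectives and a finite set of unary connectives. Each binary connective $\alpha$ comes with an arbitrary function $f_\alpha:[0,1]^2\to[0,1]$ and each unary connective $\rho$ with an arbitrary function $f_\rho:[0,1]\to[0,1]$. Formulas are built recursively: atomic propositions are formulas; if $\sigma_1,\sigma_2$ are formulas then so are $\sigma_1\,\alpha\,\sigma_2$ and $\rho\sigma_1$. The subformulas of $\sigma_1\,\alpha\,\sigma_2$ are $\sigma_1,\sigma_2$; the subformula of $\rho\sigma$ is $\sigma$. A model $M$ assigns a value in $[0,1]$ to each atomic proposition; values of compound formulas are computed recursively via $f_\alpha,f_\rho$. A sentence is $(\sigma_1,\ldots,\sigma_k,S)$ with $\sigma_1,\ldots,\sigma_k$ pairwise distinct formulas and $S\subseteq[0,1]^k$; $M\models(\sigma_1,\ldots,\sigma_k,S)$ iff $(s_1,\ldots,s_k)\in S$ where $s_i$ is the value of $\sigma_i$ in $M$. $\Gamma\models\gamma$ means every model of all sentences in $\Gamma$ is a model of $\gamma$. $\Gamma\vdash\gamma$ means $\gamma$ is derivable from $\Gamma$ by finitely many applications of the following axiom and rules. (A) For every formula $\sigma$: $(\sigma,[0,1])$. (R1) For a permutation $\pi$ of $\{1,\ldots,k\}$: from $(\sigma_1,\ldots,\sigma_k,S)$ infer $(\sigma_{\pi(1)},\ldots,\sigma_{\pi(k)},S')$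 with $S'=\{(s_{\pi(1)},\ldots,s_{\pi(k)}):(s_1,\ldots,s_k)\in S\}$. (R2) From $(\sigma_1,\ldots,\sigma_k,S)$ infer $(\sigma_1,\ldots,\sigma_k,\sigma_{k+1},\ldots,\sigma_m,S\times[0,1]^{m-k})$ (for formulas $\sigma_{k+1},\ldots,\sigma_m$ making all components distinct). (R3) From $(\sigma_1,\ldots,\sigma_k,S_1)$ and $(\sigma_1,\ldots,\sigma_k,S_2)$ infer $(\sigma_1,\ldots,\sigma_k,S_1\cap S_2)$. (R4) For $0<r<k$: from $(\sigma_1,\ldots,\sigma_k,S)$ infer $(\sigma_1,\ldots,\sigma_{k-r},S')$ with $S'=\{(s_1,\ldots,s_{k-r}):(s_1,\ldots,s_k)\in S\}$. (R5) From $(\sigma_1,\ldots,\sigma_k,S)$ infer $(\sigma_1,\ldots,\sigma_k,S')$ whenever $S\subseteq S'\subseteq[0,1]^k$. (R6) From $(\sigma_1,\ldots,\sigma_k,S)$ infer $(\sigma_1,\ldots,\sigma_k,S')$, where $S'$ is the set of $(s_1,\ldots,s_k)\in S$ such that (a) $f_\alpha(s_i,s_j)=s_m$ whenever $\sigma_m$ is $\sigma_i\,\alpha\,\sigma_j$ for a binary connective $\alpha$, and (b) $f_\rho(s_i)=s_j$ whenever $\sigma_j$ is $\rho\sigma_i$ for a unary connective $\rho$. -}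

module Defs where

open import Algebra.Core using (Op₁; Op₂)
open import Algebra.Definitions using (Congruent₁; Congruent₂)
open import Data.Fin.Base using (Fin)
open import Data.Fin.Permutation using (Permutation′; _⟨$⟩ʳ_)
open import Data.List.Base using (List)
open import Data.List.Membership.Propositional using () renaming (_∈_ to _∈ᴸ_)
open import Data.List.Relation.Unary.All using (All)
open import Data.Nat.Base using (ℕ; suc) renaming (_+_ to _+ᴺ_; _≤_ to _≤ᴺ_; _⊔_ to _⊔ᴺ_)
import Data.Nat.Properties as ℕₚ
open import Data.Product.Base using (Σ; ∃; _×_; _,_)
open import Data.Rational.Base using (ℚ; 0ℚ; 1ℚ; ½; _+_; _-_; _*_; _≤_; _<_; ∣_∣; positive)
import Data.Rational.Properties as ℚₚ
open import Data.Rational.Solver using (module +-*-Solver)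
open import Data.Vec.Base using (Vec; []; _∷_; _++_; lookup; map; tabulate; take)
open import Data.Vec.Relation.Binary.Pointwise.Inductive as Pointwise using (Pointwise; []; _∷_)
open import Data.Vec.Relation.Unary.Unique.Propositional using (Unique)
open import Level using (0ℓ)
open import Relation.Binary.Bundles using (Setoid)
open import Relation.Binary.Definitions using (_Respects_; Reflexive; Symmetric; Transitive)
open import Relation.Binary.PropositionalEquality using (_≡_; refl; sym; trans; cong; subst)
open import Relation.Unary using (Pred; _∈_; _⊆_; _∩_; U)

------------------------------------------------------------------------
-- The real unit interval

infix 4 _≈ᴿ_ _≤ᴿ_ _≈_

-- Cauchy sequences of rationals; equality of reals is _≈ᴿ_, not _≡_.
record ℝ : Set where
  constructor mkℝ
  field
    seq    : ℕ → ℚ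
    cauchy : ∀ ε → 0ℚ < ε →
             ∃ λ N → ∀ m n → N ≤ᴺ m → N ≤ᴺ n → ∣ seq m - seq n ∣ ≤ ε

open ℝ using (seq)

_≈ᴿ_ : ℝ → ℝ → Set
x ≈ᴿ y = ∀ ε → 0ℚ < ε →
         ∃ λ N → ∀ n → N ≤ᴺ n → ∣ seq x n - seq y n ∣ ≤ ε

_≤ᴿ_ : ℝ → ℝ → Set
x ≤ᴿ y = ∀ ε → 0ℚ < ε →
         ∃ λ N → ∀ n → N ≤ᴺ n → seq x n ≤ seq y n + ε

∣p-p∣≤ε : ∀ p {ε} → 0ℚ < ε → ∣ p - p ∣ ≤ ε
∣p-p∣≤ε p 0<ε = subst (λ d → ∣ d ∣ ≤ _) (sym (ℚₚ.+-inverseʳ p)) (ℚₚ.<⇒≤ 0<ε)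

fromℚ : ℚ → ℝ
fromℚ p = mkℝ (λ _ → p) (λ _ 0<ε → 0 , λ _ _ _ _ → ∣p-p∣≤ε p 0<ε)

≈ᴿ-refl : Reflexive _≈ᴿ_
≈ᴿ-refl {x} _ 0<ε = 0 , λ n _ → ∣p-p∣≤ε (seq x n) 0<ε

≈ᴿ-sym : Symmetric _≈ᴿ_
≈ᴿ-sym {x} {y} x≈y ε 0<ε with x≈y ε 0<ε
... | N , h = N , λ n N≤n →
  subst (_≤ ε) (swap (seq x n) (seq y n)) (h n N≤n)
  where
  open +-*-Solver
  swap : ∀ p q → ∣ p - q ∣ ≡ ∣ q - p ∣
  swap p q = trans (sym (ℚₚ.∣-p∣≡∣p∣ (p - q)))
    (cong ∣_∣ (solve 2 (λ a b → :- (a :- b) := b :- a) refl p q))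

≈ᴿ-trans : Transitive _≈ᴿ_
≈ᴿ-trans {x} {y} {z} x≈y y≈z ε 0<ε
  with x≈y (½ * ε) 0<ε/2 | y≈z (½ * ε) 0<ε/2
  where
  0<ε/2 : 0ℚ < ½ * ε
  0<ε/2 = ℚₚ.positive⁻¹ _ {{ℚₚ.pos*pos⇒pos ½ ε {{positive 0<ε}}}}
... | M , h | N , k = M ⊔ᴺ N , λ n le → begin
    ∣ seq x n - seq z n ∣
      ≡⟨ cong ∣_∣ (split (seq x n) (seq y n) (seq z n)) ⟩
    ∣ (seq x n - seq y n) + (seq y n - seq z n) ∣
      ≤⟨ ℚₚ.∣p+q∣≤∣p∣+∣q∣ (seq x n - seq y n) (seq y n - seq z n) ⟩
    ∣ seq x n - seq y n ∣ + ∣ seq y n - seq z n ∣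
      ≤⟨ ℚₚ.+-mono-≤ (h n (ℕₚ.m⊔n≤o⇒m≤o M N le)) (k n (ℕₚ.m⊔n≤o⇒n≤o M N le)) ⟩
    ½ * ε + ½ * ε
      ≡⟨ ℚₚ.*-distribʳ-+ ε ½ ½ ⟨
    1ℚ * ε
      ≡⟨ ℚₚ.*-identityˡ ε ⟩
    ε ∎
  where
  open ℚₚ.≤-Reasoning
  open +-*-Solver
  split : ∀ p q r → p - r ≡ (p - q) + (q - r)
  split = solve 3 (λ a b c → a :- c := (a :- b) :+ (b :- c)) refl

record 𝕀 : Set where
  constructor mk𝕀
  field
    value : ℝ
    0≤    : fromℚ 0ℚ ≤ᴿ value
    ≤1    : value ≤ᴿ fromℚ 1ℚ

open 𝕀 using (value)

-- A record rather than a synonym so that s and t can be inferred from s ≈ t.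
record _≈_ (s t : 𝕀) : Set where
  constructor mk≈
  field
    values-≈ : value s ≈ᴿ value t

𝕀-setoid : Setoid 0ℓ 0ℓ
𝕀-setoid = record
  { Carrier       = 𝕀
  ; _≈_           = _≈_
  ; isEquivalence = record
    { refl  = λ {s} → mk≈ (≈ᴿ-refl {value s})
    ; sym   = λ { {s} {t} (mk≈ p) → mk≈ (≈ᴿ-sym {value s} {value t} p) }
    ; trans = λ { {s} {t} {u} (mk≈ p) (mk≈ q) →
                  mk≈ (≈ᴿ-trans {value s} {value t} {value u} p q) }
    }
  }

private module 𝕀ₛ = Setoid 𝕀-setoid

------------------------------------------------------------------------
-- Subsets of [0,1]ᵏ

infix 4 _≋_

_≋_ : ∀ {k} → Vec 𝕀 k → Vec 𝕀 k → Set
_≋_ = Pointwise _≈_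

≋-refl : ∀ {k} {s : Vec 𝕀 k} → s ≋ s
≋-refl = Pointwise.refl 𝕀ₛ.refl

≋-sym : ∀ {k} {s t : Vec 𝕀 k} → s ≋ t → t ≋ s
≋-sym = Pointwise.sym 𝕀ₛ.sym

≋-trans : ∀ {k} {s t u : Vec 𝕀 k} → s ≋ t → t ≋ u → s ≋ u
≋-trans = Pointwise.trans 𝕀ₛ.trans

-- A subset may not tell apart two representations of the same reals.
record Subset (k : ℕ) : Set₁ where
  constructor mkSubset
  field
    members  : Pred (Vec 𝕀 k) 0ℓ
    respects : members Respects _≋_

open Subset using (members; respects)

full : ∀ {k} → Subset k
full = mkSubset U _

_∩ˢ_ : ∀ {k} → Subset k → Subset k → Subset k
S ∩ˢ T = mkSubset (members S ∩ members T)
  λ e (p , q) → respects S e p , respects T e q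

permute : ∀ {a} {A : Set a} {k} → Permutation′ k → Vec A k → Vec A k
permute π v = tabulate λ i → lookup v (π ⟨$⟩ʳ i)

permuteˢ : ∀ {k} → Permutation′ k → Subset k → Subset k
permuteˢ π S = mkSubset
  (λ t → ∃ λ s → s ∈ members S × t ≋ permute π s)
  λ e (s , s∈S , t≋) → s , s∈S , ≋-trans (≋-sym e) t≋

-- S × [0,1]ʳ
extendˢ : ∀ {k} r → Subset k → Subset (k +ᴺ r)
extendˢ {k} _ S = mkSubset (λ s → take k s ∈ members S)
  λ e → respects S (take-≋ k e)
  where
  take-≋ : ∀ k {r} {s t : Vec 𝕀 (k +ᴺ r)} → s ≋ t → take k s ≋ take k t
  take-≋ 0       _       = []
  take-≋ (suc k) {s = _ ∷ _} {_ ∷ _} (e ∷ es) = e ∷ take-≋ k es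

projectˢ : ∀ {k} r → Subset (k +ᴺ r) → Subset k
projectˢ r S = mkSubset (λ s → Σ (Vec 𝕀 r) λ t → (s ++ t) ∈ members S)
  λ e (t , st∈S) → t , respects S (Pointwise.++⁺ e ≋-refl) st∈S

------------------------------------------------------------------------
-- Real-valued logics

record Logic : Set where
  field
    #atoms #binary #unary : ℕ
    f₂      : Fin #binary → Op₂ 𝕀
    f₂-cong : ∀ α → Congruent₂ _≈_ (f₂ α)
    f₁      : Fin #unary → Op₁ 𝕀
    f₁-cong : ∀ ρ → Congruent₁ _≈_ (f₁ ρ)

module System (𝓛 : Logic) where

  open Logic 𝓛

  data Formula : Set where
    atom   : Fin #atoms → Formula
    binary : Fin #binary → Formula → Formula → Formula
    unary  : Fin #unary → Formula → Formula

  Model : Set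
  Model = Fin #atoms → 𝕀

  ⟦_⟧ : Formula → Model → 𝕀
  ⟦ atom a ⟧       M = M a
  ⟦ binary α σ τ ⟧ M = f₂ α (⟦ σ ⟧ M) (⟦ τ ⟧ M)
  ⟦ unary ρ σ ⟧    M = f₁ ρ (⟦ σ ⟧ M)

  -- Tuples (σ₁,…,σₖ) have k ≥ 1. No rule below could ever produce the
  -- valid sentence with k = 0 from an empty set of premises.
  record Sentence : Set₁ where
    constructor ⟨_,_,_⟩
    field
      {pred-arity} : ℕ
      formulas     : Vec Formula (suc pred-arity)
      distinct     : Unique formulas
      region       : Subset (suc pred-arity)

  infix 3 _⊨ₛ_ _⊨_ _⊢_

  _⊨ₛ_ : Model → Sentence → Set
  M ⊨ₛ ⟨ σs , _ , S ⟩ = map (λ σ → ⟦ σ ⟧ M) σs ∈ members S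

  _⊨_ : List Sentence → Sentence → Set₁
  Γ ⊨ γ = ∀ M → All (M ⊨ₛ_) Γ → M ⊨ₛ γ

  -- The side condition of R6: the values s respect those connectives
  -- whose arguments and result all occur in the tuple.
  Consistent : ∀ {k} → Vec Formula k → Pred (Vec 𝕀 k) 0ℓ
  Consistent σs s =
    (∀ α i j m → lookup σs m ≡ binary α (lookup σs i) (lookup σs j) →
       f₂ α (lookup s i) (lookup s j) ≈ lookup s m)
    ×
    (∀ ρ i j → lookup σs j ≡ unary ρ (lookup σs i) →
       f₁ ρ (lookup s i) ≈ lookup s j)

  consistentˢ : ∀ {k} → Vec Formula k → Subset k
  consistentˢ σs = mkSubset (Consistent σs) resp
    where
    resp : Consistent σs Respects _≋_
    resp {s} {t} e (h₂ , h₁) =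
      (λ α i j m eq → trans₃ (f₂-cong α (e at i) (e at j)) (h₂ α i j m eq) (e at m)) ,
      (λ ρ i j eq → trans₃ (f₁-cong ρ (e at i)) (h₁ ρ i j eq) (e at j))
      where
      _at_ = Pointwise.lookup
      trans₃ : ∀ {a a′ b b′} → a ≈ a′ → a ≈ b → b ≈ b′ → a′ ≈ b′
      trans₃ p q r = 𝕀ₛ.trans (𝕀ₛ.sym p) (𝕀ₛ.trans q r)

  data _⊢_ (Γ : List Sentence) : Sentence → Set₁ where
    premise : ∀ {γ} → γ ∈ᴸ Γ → Γ ⊢ γ
    A  : ∀ σ {d} → Γ ⊢ ⟨ σ ∷ [] , d , full ⟩
    R1 : ∀ {k} {σs : Vec Formula (suc k)} {d S} (π : Permutation′ (suc k)) {d′} →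
         Γ ⊢ ⟨ σs , d , S ⟩ →
         Γ ⊢ ⟨ permute π σs , d′ , permuteˢ π S ⟩
    R2 : ∀ {k r} {σs : Vec Formula (suc k)} {d S} (τs : Vec Formula r) {d′} →
         Γ ⊢ ⟨ σs , d , S ⟩ →
         Γ ⊢ ⟨ σs ++ τs , d′ , extendˢ r S ⟩
    R3 : ∀ {k} {σs : Vec Formula (suc k)} {d S₁ S₂} →
         Γ ⊢ ⟨ σs , d , S₁ ⟩ →
         Γ ⊢ ⟨ σs , d , S₂ ⟩ →
         Γ ⊢ ⟨ σs , d , S₁ ∩ˢ S₂ ⟩
    R4 : ∀ {k r} (σs : Vec Formula (suc k)) (τs : Vec Formula (suc r)) {d d′ S} →
         Γ ⊢ ⟨ σs ++ τs , d , S ⟩ →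
         Γ ⊢ ⟨ σs , d′ , projectˢ (suc r) S ⟩
    R5 : ∀ {k} {σs : Vec Formula (suc k)} {d S S′} →
         members S ⊆ members S′ →
         Γ ⊢ ⟨ σs , d , S ⟩ →
         Γ ⊢ ⟨ σs , d , S′ ⟩
    R6 : ∀ {k} {σs : Vec Formula (suc k)} {d S} →
         Γ ⊢ ⟨ σs , d , S ⟩ →
         Γ ⊢ ⟨ σs , d , S ∩ˢ consistentˢ σs ⟩

{-# OPTIONS --safe #-}

-- For completeness, collect all subformulas occurring in Γ and γ into one tuple.
-- Each premise can be moved to this tuple by R1, R2, R4 and R5; intersect the
-- results with R3 and apply R6. A point of the resulting region agrees with the
-- values of an actual model, because the tuple is closed under subformulas.
-- That model satisfies Γ, hence γ, so γ follows by moving back.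
module Submission where

import Data.Fin.Properties as Fin
open import Data.Fin.Permutation using (Permutation; Permutation′; permutation; ↔⇒≡; _⟨$⟩ʳ_)
open import Data.List.Base as List using (List; []; _∷_)
import Data.List.Membership.Propositional as List
import Data.List.Membership.Propositional.Properties as List
import Data.List.Relation.Binary.Subset.Propositional as List
open import Data.List.Relation.Unary.All as AllL using ([]; _∷_)
import Data.List.Relation.Unary.AllPairs as AllPairsL
import Data.List.Relation.Unary.Any as AnyL
import Data.List.Relation.Unary.Unique.Propositional as List
import Data.List.Relation.Unary.Unique.DecPropositional.Properties as List
open import Data.Nat.Base using (suc)
open import Data.Product.Base using (∃; _×_; _,_; proj₁; proj₂)
open import Data.Vec.Base
  using (Vec; []; _∷_; _++_; lookup; map; tabulate; take; head; toList; fromList)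
import Data.Vec.Membership.DecPropositional as Membership
open import Data.Vec.Membership.Propositional using (_∈_)
open import Data.Vec.Membership.Propositional.Properties
  using (∈-lookup; ∈-++⁺ˡ; ∈-++⁺ʳ; ∈-toList⁺; ∈-toList⁻; ∈-fromList⁺; ∈-fromList⁻)
open import Data.Vec.Properties
  using (map-++; lookup-map; take-map; tabulate∘lookup; tabulate-∘; tabulate-cong)
open import Data.Vec.Relation.Binary.Pointwise.Inductive using ([]; _∷_)
open import Data.Vec.Relation.Unary.All using ([]; _∷_)
import Data.Vec.Relation.Unary.All.Properties as All
open import Data.Vec.Relation.Unary.AllPairs using ([]; _∷_)
import Data.Vec.Relation.Unary.AllPairs.Properties as AllPairs
open import Data.Vec.Relation.Unary.Any as Any using (here; there)
open import Data.Vec.Relation.Unary.Any.Properties using (lookup-index; ++⁻)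
open import Data.Vec.Relation.Unary.Unique.Propositional using (Unique)
open import Data.Vec.Relation.Unary.Unique.Propositional.Properties using (lookup-injective)
open import Data.Sum.Base using ([_,_]′)
open import Data.Unit.Base using (tt)
open import Function.Base using (_∘_; id)
open import Function.Bundles using (_⇔_; mk⇔)
open import Relation.Binary.Bundles using (Setoid)
open import Relation.Binary.Definitions using (DecidableEquality)
open import Relation.Binary.PropositionalEquality
open import Relation.Nullary using (¬_; yes; no; ¬?; contradiction; map′; _×-dec_)
open import Defs

private module 𝕀ₛ = Setoid 𝕀-setoid

-- Vectors, maps and pointwise equality.

take-++ : ∀ {a} {A : Set a} {m n} (xs : Vec A m) (ys : Vec A n) → take m (xs ++ ys) ≡ xs
take-++ []       ys = refl
take-++ (x ∷ xs) ys = cong (x ∷_) (take-++ xs ys)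

take-map-++ : ∀ {a b} {A : Set a} {B : Set b} (f : A → B) {m n} (xs : Vec A m) (ys : Vec A n) →
              take m (map f (xs ++ ys)) ≡ map f xs
take-map-++ f xs ys = trans (take-map f _ (xs ++ ys)) (cong (map f) (take-++ xs ys))

map-permute : ∀ {a b} {A : Set a} {B : Set b} {n} (f : A → B) (π : Permutation′ n) xs →
              map f (permute π xs) ≡ permute π (map f xs)
map-permute f π xs = trans (sym (tabulate-∘ f (lookup xs ∘ (π ⟨$⟩ʳ_))))
  (tabulate-cong λ i → sym (lookup-map (π ⟨$⟩ʳ i) f xs))

lookup-map-index : ∀ {a b} {A : Set a} {B : Set b} (f : A → B) {n} {xs : Vec A n} {x}
                   (x∈xs : x ∈ xs) → lookup (map f xs) (Any.index x∈xs) ≡ f x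
lookup-map-index f {xs = xs} x∈xs =
  trans (lookup-map (Any.index x∈xs) f xs) (cong f (sym (lookup-index x∈xs)))

fromList-unique : ∀ {a} {A : Set a} {xs : List A} → List.Unique xs → Unique (fromList xs)
fromList-unique AllPairsL.[]          = []
fromList-unique (x∉xs AllPairsL.∷ xs!) = All.fromList⁺ x∉xs ∷ fromList-unique xs!

map-≋ : ∀ {a} {A : Set a} {n} {f g : A → 𝕀} (xs : Vec A n) →
        (∀ {x} → x ∈ xs → f x ≈ g x) → map f xs ≋ map g xs
map-≋ []       _   = []
map-≋ (x ∷ xs) f≈g = f≈g (here refl) ∷ map-≋ xs (f≈g ∘ there)

map-≋⁻ : ∀ {a} {A : Set a} {n} {f g : A → 𝕀} {xs : Vec A n} →
         map f xs ≋ map g xs → ∀ {x} → x ∈ xs → f x ≈ g x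
map-≋⁻ {xs = _ ∷ _} (e ∷ _)  (here refl) = e
map-≋⁻ {xs = _ ∷ _} (_ ∷ es) (there x∈)  = map-≋⁻ es x∈

-- Vectors without repetition.

module _ {a} {A : Set a} where

  -- Sending each entry to its position in the other vector gives maps both ways; they are mutually
  -- inverse because lookup in a vector without repetition is injective. The lengths are not assumed
  -- equal, so that their equality can be read off from the bijection.
  matching : ∀ {m n} {xs : Vec A m} {ys : Vec A n} → Unique xs → Unique ys →
             (∀ {x} → x ∈ xs → x ∈ ys) → (∀ {x} → x ∈ ys → x ∈ xs) →
             ∃ λ (π : Permutation n m) → ∀ i → lookup xs (π ⟨$⟩ʳ i) ≡ lookup ys i
  matching {xs = xs} {ys} xs! ys! xs⊆ys ys⊆xs =
    permutation f g (λ j → lookup-injective xs! _ _ (trans (f-lookup (g j)) (g-lookup j)))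
                    (λ i → lookup-injective ys! _ _ (trans (g-lookup (f i)) (f-lookup i)))
    , f-lookup
    where
    f = λ i → Any.index (ys⊆xs (∈-lookup i ys))
    g = λ j → Any.index (xs⊆ys (∈-lookup j xs))
    f-lookup : ∀ i → lookup xs (f i) ≡ lookup ys i
    f-lookup i = sym (lookup-index (ys⊆xs (∈-lookup i ys)))
    g-lookup : ∀ j → lookup ys (g j) ≡ lookup xs j
    g-lookup j = sym (lookup-index (xs⊆ys (∈-lookup j xs)))

module _ {a} {A : Set a} (_≟_ : DecidableEquality A) where

  open Membership _≟_ using (_∈?_)

  -- Used to realise an arbitrary point of a region as the values of some valuation. Distinctness
  -- makes the assignment by position well defined.
  interpolate : ∀ {b} {B : Set b} {n} {xs : Vec A (suc n)} → Unique xs → (ys : Vec B (suc n)) →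
                ∃ λ (f : A → B) → map f xs ≡ ys
  interpolate {B = B} {xs = xs} xs! ys = f , (begin
    map f xs                        ≡⟨ tabulate∘lookup (map f xs) ⟨
    tabulate (lookup (map f xs))    ≡⟨ tabulate-cong (λ i → trans (lookup-map i f xs) (f-lookup i)) ⟩
    tabulate (lookup ys)            ≡⟨ tabulate∘lookup ys ⟩
    ys                              ∎)
    where
    open ≡-Reasoning
    f : A → B
    f x with x ∈? xs
    ... | yes x∈xs = lookup ys (Any.index x∈xs)
    -- Off `xs` the value is arbitrary; `head ys` serves as default since `ys` is nonempty.
    ... | no  _    = head ys
    f-lookup : ∀ i → f (lookup xs i) ≡ lookup ys i
    f-lookup i with lookup xs i ∈? xs
    ... | yes x∈xs = cong (lookup ys) (lookup-injective xs! _ _ (sym (lookup-index x∈xs)))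
    ... | no  x∉xs = contradiction (∈-lookup i xs) x∉xs

  -- `xs` is kept as a prefix, so that R2 can append `rest` and R4 can drop it.
  record Union {n} (xs : Vec A n) (l : List A) : Set a where
    field
      {size} : _
      rest   : Vec A size
      unique : Unique (xs ++ rest)
      ∈⁺     : ∀ {x} → x List.∈ l → x ∈ xs ++ rest
      ∈⁻     : ∀ {x} → x ∈ rest → x List.∈ l

  union : ∀ {n} {xs : Vec A n} → Unique xs → ∀ l → Union xs l
  union {xs = xs} xs! l = record
    { rest   = fromList new
    ; unique = AllPairs.++⁺ xs! (fromList-unique (List.deduplicate-! _≟_ _))
        (All.lookup⁻ λ i → All.lookup⁻ λ j eq →
          proj₂ (new⁻ (∈-fromList⁻ (∈-lookup j (fromList new))))
            (subst (_∈ xs) eq (∈-lookup i xs)))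
    ; ∈⁺     = new⁺
    ; ∈⁻     = proj₁ ∘ new⁻ ∘ ∈-fromList⁻
    }
    where
    new? = λ y → ¬? (y ∈? xs)
    new  = List.deduplicate _≟_ (List.filter new? l)
    new⁻ : ∀ {x} → x List.∈ new → x List.∈ l × ¬ x ∈ xs
    new⁻ = List.∈-filter⁻ new? ∘ List.∈-deduplicate⁻ _≟_ _
    new⁺ : ∀ {x} → x List.∈ l → x ∈ xs ++ fromList new
    new⁺ {x} x∈l with x ∈? xs
    ... | yes x∈xs = ∈-++⁺ˡ x∈xs
    ... | no  x∉xs = ∈-++⁺ʳ xs (∈-fromList⁺ (List.∈-deduplicate⁺ _≟_ (List.∈-filter⁺ new? x∈l x∉xs)))

-- Valuations of formulas.

module _ (𝓛 : Logic) where

  open Logic 𝓛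
  open System 𝓛
  open Subset
  open Sentence

  -- Values of compound formulas need not respect the connectives. As the
  -- components of a sentence are distinct, valuations realise all of [0,1]ᵏ.
  Valuation : Set
  Valuation = Formula → 𝕀

  infix 3 _⊨ᵛ_

  _⊨ᵛ_ : Valuation → Sentence → Set
  v ⊨ᵛ δ = members (region δ) (map v (formulas δ))

  ⊨ᵛ-resp : ∀ {v w} δ → (∀ {σ} → σ ∈ formulas δ → v σ ≈ w σ) → v ⊨ᵛ δ → w ⊨ᵛ δ
  ⊨ᵛ-resp δ v≈w = respects (region δ) (map-≋ (formulas δ) v≈w)

  _≟_ : DecidableEquality Formula
  atom a       ≟ atom b         = map′ (cong atom) (λ { refl → refl }) (a Fin.≟ b)
  binary α σ τ ≟ binary β σ′ τ′ = map′ (λ { (refl , refl , refl) → refl })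
    (λ { refl → refl , refl , refl }) (α Fin.≟ β ×-dec (σ ≟ σ′ ×-dec τ ≟ τ′))
  unary ρ σ    ≟ unary ρ′ σ′    = map′ (λ { (refl , refl) → refl })
    (λ { refl → refl , refl }) (ρ Fin.≟ ρ′ ×-dec σ ≟ σ′)
  atom _       ≟ binary _ _ _   = no λ ()
  atom _       ≟ unary _ _      = no λ ()
  binary _ _ _ ≟ atom _         = no λ ()
  binary _ _ _ ≟ unary _ _      = no λ ()
  unary _ _    ≟ atom _         = no λ ()
  unary _ _    ≟ binary _ _ _   = no λ ()

  -- Soundness.

  soundness : ∀ {Γ γ} → Γ ⊢ γ → Γ ⊨ γ
  soundness (premise γ∈Γ) M MΓ = AllL.lookup MΓ γ∈Γ
  soundness (A _) M MΓ = tt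
  soundness (R1 {σs = σs} π ⊢δ) M MΓ =
    _ , soundness ⊢δ M MΓ ,
    subst (_≋ permute π (map v σs)) (sym (map-permute v π σs)) ≋-refl
    where v = λ σ → ⟦ σ ⟧ M
  soundness (R2 {σs = σs} {S = S} τs ⊢δ) M MΓ = subst (members S)
    (sym (take-map-++ _ σs τs)) (soundness ⊢δ M MΓ)
  soundness (R3 ⊢δ₁ ⊢δ₂) M MΓ = soundness ⊢δ₁ M MΓ , soundness ⊢δ₂ M MΓ
  -- The witness for the dropped coordinates is the tuple of values of `τs` in `M`.
  soundness (R4 σs τs {S = S} ⊢δ) M MΓ =
    _ , subst (members S) (map-++ _ σs τs) (soundness ⊢δ M MΓ)
  soundness (R5 S⊆S′ ⊢δ) M MΓ = S⊆S′ (soundness ⊢δ M MΓ)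
  -- The side condition holds because `⟦_⟧` computes through the connectives; only lookups in a
  -- mapped vector have to be rewritten.
  soundness (R6 {σs = σs} ⊢δ) M MΓ = soundness ⊢δ M MΓ ,
    (λ α i j m eq → 𝕀ₛ.reflexive (begin
      f₂ α (lookup vs i) (lookup vs j) ≡⟨ cong₂ (f₂ α) (lookup-map i v σs) (lookup-map j v σs) ⟩
      v (binary α (lookup σs i) (lookup σs j)) ≡⟨ cong v eq ⟨
      v (lookup σs m)                  ≡⟨ lookup-map m v σs ⟨
      lookup vs m                      ∎)) ,
    (λ ρ i j eq → 𝕀ₛ.reflexive (begin
      f₁ ρ (lookup vs i)           ≡⟨ cong (f₁ ρ) (lookup-map i v σs) ⟩
      v (unary ρ (lookup σs i))    ≡⟨ cong v eq ⟨
      v (lookup σs j)              ≡⟨ lookup-map j v σs ⟨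
      lookup vs j                  ∎))
    where
    open ≡-Reasoning
    v  = λ σ → ⟦ σ ⟧ M
    vs = map v σs

  -- Moving a sentence to another tuple.

  module _ {Γ : List Sentence} where

    -- R1 reorders the tuple and R5 enlarges the region. The inclusion that R5 needs can be tested
    -- on valuations, since `interpolate` writes every point as `map v σs`.
    permute-sentence : ∀ γ δ → (∀ {σ} → σ ∈ formulas γ → σ ∈ formulas δ) →
      (∀ {σ} → σ ∈ formulas δ → σ ∈ formulas γ) →
      (∀ v → v ⊨ᵛ γ → v ⊨ᵛ δ) → Γ ⊢ γ → Γ ⊢ δ
    permute-sentence ⟨ σs , σs! , S ⟩ ⟨ τs , τs! , T ⟩ σs⊆τs τs⊆σs γ⇒δ ⊢γ
      with matching σs! τs! σs⊆τs τs⊆σs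
    ... | π , π-lookup with ↔⇒≡ π
    -- Equal lengths make `π` a permutation of a single index set, as R1 demands; the next equation
    -- identifies `permute π σs` with `τs`.
    ... | refl with trans (tabulate-cong π-lookup) (tabulate∘lookup τs)
    ... | refl = R5 S′⊆T (R1 π ⊢γ)
      where
      S′⊆T : ∀ {t} → members (permuteˢ π S) t → members T t
      S′⊆T {t} (s , s∈S , t≋πs) with interpolate _≟_ σs! s
      ... | v , refl = respects T
        (subst (_≋ t) (sym (map-permute v π σs)) (≋-sym t≋πs)) (γ⇒δ v s∈S)

    -- R4 must drop at least one component.
    restrict : ∀ {k r} (σs : Vec Formula (suc k)) (τs : Vec Formula r) {d d′ S T} →
      (∀ v → v ⊨ᵛ ⟨ σs ++ τs , d , S ⟩ → v ⊨ᵛ ⟨ σs , d′ , T ⟩) →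
      Γ ⊢ ⟨ σs ++ τs , d , S ⟩ → Γ ⊢ ⟨ σs , d′ , T ⟩
    restrict σs [] γ⇒δ ⊢γ =
      permute-sentence _ _ ([ id , (λ ()) ]′ ∘ ++⁻ σs) ∈-++⁺ˡ γ⇒δ ⊢γ
    restrict σs τs@(_ ∷ _) {d} {S = S} {T} γ⇒δ ⊢γ = R5 S′⊆T (R4 σs τs ⊢γ)
      where
      S′⊆T : ∀ {s} → members (projectˢ _ S) s → members T s
      -- One valuation realises the projected point together with its witness, so `γ⇒δ` applies.
      S′⊆T {s} (t , st∈S) with interpolate _≟_ d (s ++ t)
      ... | v , eq = subst (members T)
        (trans (sym (take-map-++ v σs τs)) (trans (cong (take _) eq) (take-++ s t)))
        (γ⇒δ v (subst (members S) (sym eq) st∈S))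

    -- R2 adds to `σs` the missing formulas of `τs`, a reordering brings `τs` to the front, and
    -- `restrict` drops the rest. The two enlarged tuples have the same members, namely those of
    -- `σs` and `τs`.
    transfer : ∀ γ δ → (∀ v → v ⊨ᵛ γ → v ⊨ᵛ δ) → Γ ⊢ γ → Γ ⊢ δ
    transfer ⟨ σs , σs! , S ⟩ ⟨ τs , τs! , T ⟩ γ⇒δ ⊢γ =
      -- The intermediate region is a cylinder over `T`, so dropping the extra coordinates gives
      -- back `T`.
      restrict τs (rest τ∪σ) {unique τ∪σ} {S = U}
        (λ v τσ∈U → subst (members T) (take-map-++ v τs (rest τ∪σ)) τσ∈U)
        (permute-sentence ⟨ σs ++ rest σ∪τ , unique σ∪τ , extendˢ _ S ⟩ _
          ([ ∈⁺ τ∪σ ∘ ∈-toList⁺ , ∈-++⁺ˡ ∘ ∈-toList⁻ ∘ ∈⁻ σ∪τ ]′ ∘ ++⁻ σs)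
          ([ ∈⁺ σ∪τ ∘ ∈-toList⁺ , ∈-++⁺ˡ ∘ ∈-toList⁻ ∘ ∈⁻ τ∪σ ]′ ∘ ++⁻ τs)
          (λ v στ∈S → subst (members T) (sym (take-map-++ v τs (rest τ∪σ)))
            (γ⇒δ v (subst (members S) (take-map-++ v σs (rest σ∪τ)) στ∈S)))
          (R2 (rest σ∪τ) ⊢γ))
      where
      open Union
      σ∪τ = union _≟_ σs! (toList τs)
      τ∪σ = union _≟_ τs! (toList σs)
      U = extendˢ (size τ∪σ) T

  -- Premises on a common tuple.

  -- Quantifying over valuations avoids all reindexing between `σs` and the formulas of `δ`, which
  -- may overlap in any way. Closing under `≋` makes the set a `Subset`.
  pullback : ∀ {k} → Vec Formula k → Sentence → Subset k
  pullback σs δ = mkSubset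
    (λ s → ∃ λ v → s ≋ map v σs × v ⊨ᵛ δ)
    (λ s≋t (v , s≋ , v⊨δ) → v , ≋-trans (≋-sym s≋t) s≋ , v⊨δ)

  pullbacks : ∀ {k} → Vec Formula k → List Sentence → Subset k
  pullbacks σs = List.foldr (λ δ S → pullback σs δ ∩ˢ S) full

  -- The induction is on `Δ`, while the context `Γ` of the derivation stays fixed.
  ⊢-pullbacks : ∀ {Γ k} {σs : Vec Formula (suc k)} {d} Δ → Δ List.⊆ Γ →
                Γ ⊢ ⟨ σs , d , pullbacks σs Δ ⟩
  -- The empty intersection also needs a derivation; it comes from axiom A for the first formula of
  -- the tuple.
  ⊢-pullbacks {σs = σ ∷ _} [] _ = transfer ⟨ σ ∷ [] , [] ∷ [] , full ⟩ _ _ (A σ)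
  ⊢-pullbacks (δ ∷ Δ) Δ⊆Γ =
    R3 (transfer δ _ (λ v v⊨δ → v , ≋-refl , v⊨δ) (premise (Δ⊆Γ (AnyL.here refl))))
       (⊢-pullbacks Δ (Δ⊆Γ ∘ AnyL.there))

  -- The valuation witnessing membership in a pullback may differ from `v`, but it agrees with `v`
  -- on `σs`, which contains all formulas of `δ`.
  pullbacks⁻ : ∀ {k v} {σs : Vec Formula k} Δ →
    (∀ {δ σ} → δ List.∈ Δ → σ ∈ formulas δ → σ ∈ σs) →
    members (pullbacks σs Δ) (map v σs) → AllL.All (v ⊨ᵛ_) Δ
  pullbacks⁻ []      _    _                   = []
  pullbacks⁻ (δ ∷ Δ) Δ⊆σs ((w , v≋w , w⊨δ) , s∈) =
    ⊨ᵛ-resp δ (𝕀ₛ.sym ∘ map-≋⁻ v≋w ∘ Δ⊆σs (AnyL.here refl)) w⊨δ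
    ∷ pullbacks⁻ Δ (Δ⊆σs ∘ AnyL.there) s∈

  -- Subformulas and consistent valuations.

  subformulas : Formula → List Formula
  subformulas σ@(atom _)       = σ ∷ []
  subformulas σ@(binary _ τ υ) = σ ∷ subformulas τ List.++ subformulas υ
  subformulas σ@(unary _ τ)    = σ ∷ subformulas τ

  self∈subformulas : ∀ σ → σ List.∈ subformulas σ
  self∈subformulas (atom _)       = AnyL.here refl
  self∈subformulas (binary _ _ _) = AnyL.here refl
  self∈subformulas (unary _ _)    = AnyL.here refl

  -- Induction on `σ`. Atoms agree by the choice of model; for a compound formula, it and its
  -- arguments all occur in `σs`, so consistency supplies the equation for its connective.
  consistent⇒⟦⟧ : ∀ {k} {σs : Vec Formula k} v → Consistent σs (map v σs) →
    ∀ σ → (∀ {τ} → τ List.∈ subformulas σ → τ ∈ σs) → v σ ≈ ⟦ σ ⟧ (v ∘ atom)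
  consistent⇒⟦⟧ v _ (atom _) _ = 𝕀ₛ.refl
  consistent⇒⟦⟧ {σs = σs} v c@(c₂ , _) (binary α σ τ) sub = 𝕀ₛ.trans
    (𝕀ₛ.sym (subst₂ _≈_ (cong₂ (f₂ α) (lookup-map-index v σ∈) (lookup-map-index v τ∈))
      (lookup-map-index v στ∈)
      (c₂ α (Any.index σ∈) (Any.index τ∈) (Any.index στ∈)
        (trans (sym (lookup-index στ∈)) (cong₂ (binary α) (lookup-index σ∈) (lookup-index τ∈))))))
    (f₂-cong α (consistent⇒⟦⟧ v c σ σ⊆) (consistent⇒⟦⟧ v c τ τ⊆))
    where
    σ⊆ : ∀ {υ} → υ List.∈ subformulas σ → υ ∈ σs
    σ⊆ = sub ∘ AnyL.there ∘ List.∈-++⁺ˡ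
    τ⊆ : ∀ {υ} → υ List.∈ subformulas τ → υ ∈ σs
    τ⊆ = sub ∘ AnyL.there ∘ List.∈-++⁺ʳ (subformulas σ)
    σ∈ = σ⊆ (self∈subformulas σ)
    τ∈ = τ⊆ (self∈subformulas τ)
    στ∈ = sub (AnyL.here refl)
  consistent⇒⟦⟧ {σs = σs} v c@(_ , c₁) (unary ρ σ) sub = 𝕀ₛ.trans
    (𝕀ₛ.sym (subst₂ _≈_ (cong (f₁ ρ) (lookup-map-index v σ∈)) (lookup-map-index v ρσ∈)
      (c₁ ρ (Any.index σ∈) (Any.index ρσ∈)
        (trans (sym (lookup-index ρσ∈)) (cong (unary ρ) (lookup-index σ∈))))))
    (f₁-cong ρ (consistent⇒⟦⟧ v c σ (sub ∘ AnyL.there)))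
    where
    σ∈ = sub (AnyL.there (self∈subformulas σ))
    ρσ∈ = sub (AnyL.here refl)

  -- Completeness.

  completeness : ∀ {Γ γ} → Γ ⊨ γ → Γ ⊢ γ
  completeness {Γ} {γ} Γ⊨γ =
    transfer ⟨ σs , unique σ₀∪ , pullbacks σs Γ ∩ˢ consistentˢ σs ⟩ γ valid
      (R6 (⊢-pullbacks Γ id))
    where
    open Union
    all-subformulas : Sentence → List Formula
    all-subformulas = List.concatMap subformulas ∘ toList ∘ formulas
    -- Starting the tuple with a formula of `γ` makes it visibly nonempty.
    σ₀ = head (formulas γ)
    σ₀∪ = union _≟_ {xs = σ₀ ∷ []} ([] ∷ []) (List.concatMap all-subformulas (γ ∷ Γ))
    σs = (σ₀ ∷ []) ++ rest σ₀∪

    sub∈σs : ∀ {δ σ τ} → δ List.∈ γ ∷ Γ → σ ∈ formulas δ → τ List.∈ subformulas σ → τ ∈ σs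
    sub∈σs δ∈ σ∈ τ∈ = ∈⁺ σ₀∪ (List.∈-concatMap⁺ all-subformulas
      (List.lose δ∈ (List.∈-concatMap⁺ subformulas (List.lose (∈-toList⁺ σ∈) τ∈))))

    valid : ∀ v → members (pullbacks σs Γ ∩ˢ consistentˢ σs) (map v σs) → v ⊨ᵛ γ
    -- `v` itself need not respect the connectives everywhere, but `v ∘ atom` is a model agreeing
    -- with it on all formulas of `Γ` and `γ`: satisfaction of `Γ` passes from `v` to this model,
    -- and that of `γ` passes back.
    valid v (s∈ , c) = ⊨ᵛ-resp γ (𝕀ₛ.sym ∘ v≈M (AnyL.here refl)) (Γ⊨γ (v ∘ atom)
      (AllL.tabulate λ {δ} δ∈Γ → ⊨ᵛ-resp δ (v≈M (AnyL.there δ∈Γ))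
        (AllL.lookup
          (pullbacks⁻ Γ (λ δ∈ σ∈ → sub∈σs (AnyL.there δ∈) σ∈ (self∈subformulas _)) s∈) δ∈Γ)))
      where
      v≈M : ∀ {δ σ} → δ List.∈ γ ∷ Γ → σ ∈ formulas δ → v σ ≈ ⟦ σ ⟧ (v ∘ atom)
      v≈M δ∈ σ∈ = consistent⇒⟦⟧ v c _ (sub∈σs δ∈ σ∈)

theorem2 : (𝓛 : Logic) → let open System 𝓛 in
    (Γ : List Sentence) (γ : Sentence) → (Γ ⊢ γ) ⇔ (Γ ⊨ γ)
theorem2 𝓛 Γ γ = mk⇔ (soundness 𝓛) (completeness 𝓛)
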